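{- Let $G$ be a Roelcke-precompact Polish group and let $\varphi\colon G \to B$ be its Bohr compactification. Then $\varphi$ is surjective.
   Context: A topological group $G$ is Roelcke-precompact if for every open neighbourhood $U$ of the identity there is a finite set $F \subseteq G$ with $UFU = G$. The Bohr compactification of a topological group $G$ is a continuous homomorphism $\varphi\colon G \to B$ into a compact (Hausdorff) group $B$ which is universal: every continuous homomorphism from $G$ into a compact group factors uniquely through $\varphi$. -}

module Defs where

open import Algebra.Bundles using (Group)
open import Algebra.Morphism.Structures using (module GroupMorphisms)
open import Data.List.Base using (List)
open import Data.List.Relation.Unary.Any using (Any)
import Data.List.Membership.Setoid as Membership
open import Data.Nat.Base as ℕ using (ℕ)
import Data.Nat.Properties as ℕ
open import Data.Product using (Σ-syntax; ∃-syntax; ∃!; _×_; _,_; proj₁; proj₂; uncurry)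
open import Data.Product.Relation.Binary.Pointwise.NonDependent using (×-setoid)
open import Data.Rational.Base as ℚ using (ℚ; 0ℚ; ½)
import Data.Rational.Properties as ℚ
open import Data.Rational.Solver using (module +-*-Solver)
open import Data.Unit.Polymorphic using (tt)
open import Function.Metric.Structures using (IsGeneralMetric)
open import Level using (Level; 0ℓ; suc)
open import Relation.Binary.Bundles using (Setoid)
open import Relation.Binary.Core using (Rel)
open import Relation.Binary.Definitions using (_Respects_)
open import Relation.Binary.PropositionalEquality as ≡ using (_≡_)
open import Relation.Binary.Structures using (IsPartialOrder)
open import Relation.Nullary.Negation using (¬_)
open import Relation.Unary using (Pred; _∈_; _⊆_; _≐_; _∩_; _⊥_; _⊢_; ⋃; Satisfiable; _⟨×⟩_)
open import Relation.Unary.Polymorphic using (U)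

private
  variable
    ℓ : Level

  half-pos : ∀ {ε} → 0ℚ ℚ.< ε → 0ℚ ℚ.< ½ ℚ.* ε
  half-pos {ε} 0<ε = ℚ.positive⁻¹ (½ ℚ.* ε) {{ℚ.pos*pos⇒pos ½ ε {{ℚ.positive 0<ε}}}}

  halves : ∀ ε → ½ ℚ.* ε ℚ.+ ½ ℚ.* ε ≡ ε
  halves ε = ≡.trans (≡.sym (ℚ.*-distribʳ-+ ε ½ ½)) (ℚ.*-identityˡ ε)

------------------------------------------------------------------------
-- Real numbers: Cauchy sequences of rationals, with equality _≃_

record ℝ : Set where
  field
    seq    : ℕ → ℚ
    cauchy : ∀ {ε} → 0ℚ ℚ.< ε →
             ∃[ N ] ∀ {m n} → N ℕ.≤ m → N ℕ.≤ n → ℚ.∣ seq m ℚ.- seq n ∣ ℚ.< ε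

open ℝ public

infix 4 _≤ᴿ_ _<ᴿ_ _≃_

_≤ᴿ_ : Rel ℝ 0ℓ
x ≤ᴿ y = ∀ {ε} → 0ℚ ℚ.< ε → ∃[ N ] ∀ {n} → N ℕ.≤ n → seq x n ℚ.< seq y n ℚ.+ ε

_<ᴿ_ : Rel ℝ 0ℓ
x <ᴿ y = ∃[ ε ] 0ℚ ℚ.< ε × ∃[ N ] ∀ {n} → N ℕ.≤ n → seq x n ℚ.+ ε ℚ.< seq y n

_≃_ : Rel ℝ 0ℓ
x ≃ y = x ≤ᴿ y × y ≤ᴿ x

0ᴿ : ℝ
0ᴿ = record { seq = λ _ → 0ℚ ; cauchy = λ 0<ε → 0 , λ _ _ → 0<ε }

infixl 6 _+ᴿ_

_+ᴿ_ : ℝ → ℝ → ℝ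
x +ᴿ y = record { seq = λ n → seq x n ℚ.+ seq y n ; cauchy = sum-cauchy }
  where
  rearrange : ∀ a b c d → (a ℚ.+ b) ℚ.- (c ℚ.+ d) ≡ (a ℚ.- c) ℚ.+ (b ℚ.- d)
  rearrange = solve 4 (λ a b c d → (a :+ b) :- (c :+ d) := (a :- c) :+ (b :- d)) ≡.refl
    where open +-*-Solver

  sum-cauchy : ∀ {ε} → 0ℚ ℚ.< ε →
    ∃[ N ] ∀ {m n} → N ℕ.≤ m → N ℕ.≤ n →
    ℚ.∣ (seq x m ℚ.+ seq y m) ℚ.- (seq x n ℚ.+ seq y n) ∣ ℚ.< ε
  sum-cauchy {ε} 0<ε with cauchy x (half-pos 0<ε) | cauchy y (half-pos 0<ε)
  ... | M , p | N , q = M ℕ.⊔ N , λ {m} {n} i j → begin-strict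
    ℚ.∣ (seq x m ℚ.+ seq y m) ℚ.- (seq x n ℚ.+ seq y n) ∣
      ≡⟨ ≡.cong ℚ.∣_∣ (rearrange (seq x m) (seq y m) (seq x n) (seq y n)) ⟩
    ℚ.∣ (seq x m ℚ.- seq x n) ℚ.+ (seq y m ℚ.- seq y n) ∣
      ≤⟨ ℚ.∣p+q∣≤∣p∣+∣q∣ (seq x m ℚ.- seq x n) (seq y m ℚ.- seq y n) ⟩
    ℚ.∣ seq x m ℚ.- seq x n ∣ ℚ.+ ℚ.∣ seq y m ℚ.- seq y n ∣
      <⟨ ℚ.+-mono-< (p (ℕ.m⊔n≤o⇒m≤o M N i) (ℕ.m⊔n≤o⇒m≤o M N j))
                    (q (ℕ.m⊔n≤o⇒n≤o M N i) (ℕ.m⊔n≤o⇒n≤o M N j)) ⟩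
    ½ ℚ.* ε ℚ.+ ½ ℚ.* ε
      ≡⟨ halves ε ⟩
    ε ∎
    where open ℚ.≤-Reasoning

≤ᴿ-refl : ∀ {x} → x ≤ᴿ x
≤ᴿ-refl {x} {ε} 0<ε = 0 , λ {n} _ →
  ≡.subst (ℚ._< seq x n ℚ.+ ε) (ℚ.+-identityʳ (seq x n)) (ℚ.+-monoʳ-< (seq x n) 0<ε)

≤ᴿ-trans : ∀ {x y z} → x ≤ᴿ y → y ≤ᴿ z → x ≤ᴿ z
≤ᴿ-trans {x} {y} {z} x≤y y≤z {ε} 0<ε with x≤y (half-pos 0<ε) | y≤z (half-pos 0<ε)
... | M , p | N , q = M ℕ.⊔ N , λ {n} i → begin-strict
  seq x n                                 <⟨ p (ℕ.m⊔n≤o⇒m≤o M N i) ⟩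
  seq y n ℚ.+ ½ ℚ.* ε                     <⟨ ℚ.+-monoˡ-< (½ ℚ.* ε) (q (ℕ.m⊔n≤o⇒n≤o M N i)) ⟩
  (seq z n ℚ.+ ½ ℚ.* ε) ℚ.+ ½ ℚ.* ε       ≡⟨ ℚ.+-assoc (seq z n) (½ ℚ.* ε) (½ ℚ.* ε) ⟩
  seq z n ℚ.+ (½ ℚ.* ε ℚ.+ ½ ℚ.* ε)       ≡⟨ ≡.cong (seq z n ℚ.+_) (halves ε) ⟩
  seq z n ℚ.+ ε                           ∎
  where open ℚ.≤-Reasoning

-- `IsGeneralMetric` below asks for this fact as a field.
≤ᴿ-isPartialOrder : IsPartialOrder _≃_ _≤ᴿ_
≤ᴿ-isPartialOrder = record
  { isPreorder = record
    { isEquivalence = record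
      { refl  = λ {x} → ≤ᴿ-refl {x} , ≤ᴿ-refl {x}
      ; sym   = λ (p , q) → q , p
      ; trans = λ {x} {y} {z} (p , q) (r , s) →
                  ≤ᴿ-trans {x} {y} {z} p r , ≤ᴿ-trans {z} {y} {x} s q
      }
    ; reflexive = λ x≃y → proj₁ x≃y
    ; trans     = λ {x} {y} {z} → ≤ᴿ-trans {x} {y} {z}
    }
  ; antisym = λ p q → p , q
  }

------------------------------------------------------------------------
-- Topologies on setoids

-- Points are taken up to _≈_ and subsets up to _≐_. Unions are indexed by
-- types at the level of the points; under excluded middle this is no
-- restriction, since subsets are then classified by maps into Bool.
record Topology (S : Setoid ℓ ℓ) : Set (suc (suc ℓ)) where
  open Setoid S using (Carrier; _≈_)
  field
    Open      : Pred (Pred Carrier ℓ) (suc ℓ)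
    open-≈    : ∀ {V} → Open V → V Respects _≈_
    open-≐    : ∀ {V W} → V ≐ W → Open V → Open W
    open-full : Open U
    open-∩    : ∀ {V W} → Open V → Open W → Open (V ∩ W)
    open-⋃    : ∀ (I : Set ℓ) (V : I → Pred Carrier ℓ) → (∀ i → Open (V i)) → Open (⋃ I V)

Continuous : {S T : Setoid ℓ ℓ} → Topology S → Topology T →
             (Setoid.Carrier S → Setoid.Carrier T) → Set (suc ℓ)
Continuous 𝒮 𝒯 f = ∀ {V} → Topology.Open 𝒯 V → Topology.Open 𝒮 (f ⊢ V)

productTopology : {S T : Setoid ℓ ℓ} → Topology S → Topology T → Topology (×-setoid S T)
productTopology {ℓ} {S} {T} 𝒮 𝒯 = record
  { Open      = λ W → W Respects Setoid._≈_ (×-setoid S T) × (∀ {z} → z ∈ W → Box W z)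
  ; open-≈    = proj₁
  ; open-≐    = λ (V⊆W , W⊆V) (resp , box) →
      (λ z≈z′ z∈W → V⊆W (resp z≈z′ (W⊆V z∈W))) , λ z∈W → widen V⊆W (box (W⊆V z∈W))
  ; open-full = (λ _ _ → tt) ,
      λ _ → U , U , 𝒮.open-full , 𝒯.open-full , (tt , tt) , λ _ → tt
  ; open-∩    = λ (resp , box) (resp′ , box′) →
      (λ z≈z′ (p , q) → resp z≈z′ p , resp′ z≈z′ q) , λ (p , q) → meet (box p) (box′ q)
  ; open-⋃    = λ I V V-open →
      (λ z≈z′ (i , p) → i , proj₁ (V-open i) z≈z′ p) ,
      λ (i , p) → widen (λ q → i , q) (proj₂ (V-open i) p)
  }
  where
  module 𝒮 = Topology 𝒮
  module 𝒯 = Topology 𝒯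
  Point = Setoid.Carrier (×-setoid S T)

  Box : Pred Point ℓ → Pred Point (suc ℓ)
  Box W z = ∃[ O ] ∃[ P ] 𝒮.Open O × 𝒯.Open P × z ∈ (O ⟨×⟩ P) × (O ⟨×⟩ P) ⊆ W

  widen : ∀ {V W z} → V ⊆ W → Box V z → Box W z
  widen V⊆W (O , P , O-open , P-open , z∈ , sub) = O , P , O-open , P-open , z∈ , λ p → V⊆W (sub p)

  meet : ∀ {V W z} → Box V z → Box W z → Box (V ∩ W) z
  meet (O , P , o , p , (a , b) , s) (O′ , P′ , o′ , p′ , (a′ , b′) , s′) =
    O ∩ O′ , P ∩ P′ , 𝒮.open-∩ o o′ , 𝒯.open-∩ p p′ , ((a , a′) , (b , b′)) ,
    λ ((c , c′) , (d , d′)) → s (c , d) , s′ (c′ , d′)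

module _ {S : Setoid ℓ ℓ} (𝒯 : Topology S) where
  open Setoid S using (Carrier; _≈_)
  open Topology 𝒯 using (Open)

  Hausdorff : Set (suc ℓ)
  Hausdorff = ∀ x y → ¬ x ≈ y → ∃[ V ] ∃[ W ] Open V × Open W × x ∈ V × y ∈ W × V ⊥ W

  Compact : Set (suc ℓ)
  Compact = ∀ (I : Set ℓ) (V : I → Pred Carrier ℓ) → (∀ i → Open (V i)) → (∀ x → x ∈ ⋃ I V) →
            Σ[ is ∈ List I ] ∀ x → Any (λ i → x ∈ V i) is

  -- A sequence enumerates a nonempty countable set, possibly with repetitions.
  Separable : Set (suc ℓ)
  Separable = Σ[ s ∈ (ℕ → Carrier) ] ∀ {V} → Open V → Satisfiable V → ∃[ n ] s n ∈ V

  IsMetric : (Carrier → Carrier → ℝ) → Set ℓ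
  IsMetric = IsGeneralMetric _≈_ _≃_ _≤ᴿ_ 0ᴿ _+ᴿ_

  module _ (d : Carrier → Carrier → ℝ) where

    MetricOpen : Pred (Pred Carrier ℓ) ℓ
    MetricOpen V = V Respects _≈_ ×
      (∀ {x} → x ∈ V → ∃[ r ] 0ᴿ <ᴿ r × (∀ {y} → d x y <ᴿ r → y ∈ V))

    Induces : Set (suc ℓ)
    Induces = ∀ V → (Open V → MetricOpen V) × (MetricOpen V → Open V)

    CauchySequence : Pred (ℕ → Carrier) 0ℓ
    CauchySequence s = ∀ {r} → 0ᴿ <ᴿ r →
      ∃[ N ] ∀ {m n} → N ℕ.≤ m → N ℕ.≤ n → d (s m) (s n) <ᴿ r

    ConvergesTo : (ℕ → Carrier) → Pred Carrier 0ℓ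
    ConvergesTo s x = ∀ {r} → 0ᴿ <ᴿ r → ∃[ N ] ∀ {n} → N ℕ.≤ n → d (s n) x <ᴿ r

    Complete : Set ℓ
    Complete = ∀ s → CauchySequence s → ∃[ x ] ConvergesTo s x

  CompletelyMetrizable : Set (suc ℓ)
  CompletelyMetrizable = ∃[ d ] IsMetric d × Induces d × Complete d

  Polish : Set (suc ℓ)
  Polish = Separable × CompletelyMetrizable

------------------------------------------------------------------------
-- Topological groups

record TopologicalGroup ℓ : Set (suc (suc ℓ)) where
  field
    group : Group ℓ ℓ

  open Group group public

  field
    topology      : Topology setoid
    ∙-continuous  : Continuous (productTopology topology topology) topology (uncurry _∙_)
    ⁻¹-continuous : Continuous topology topology _⁻¹

  open Topology topology public

IsPolishGroup : TopologicalGroup ℓ → Set (suc ℓ)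
IsPolishGroup G = Polish (TopologicalGroup.topology G)

IsCompactGroup : TopologicalGroup ℓ → Set (suc ℓ)
IsCompactGroup G = Compact topology × Hausdorff topology
  where open TopologicalGroup G using (topology)

RoelckePrecompact : TopologicalGroup ℓ → Set (suc ℓ)
RoelckePrecompact G =
  ∀ {V} → Open V → ε ∈ V →
  Σ[ F ∈ List Carrier ] ∀ g → ∃[ u ] ∃[ f ] ∃[ v ] u ∈ V × f ∈F F × v ∈ V × g ≈ (u ∙ f) ∙ v
  where
  open TopologicalGroup G
  open Membership setoid using () renaming (_∈_ to _∈F_)

record ContinuousHom (G H : TopologicalGroup ℓ) : Set (suc ℓ) where
  private
    module G = TopologicalGroup G
    module H = TopologicalGroup H
  open GroupMorphisms G.rawGroup H.rawGroup using (IsGroupHomomorphism)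
  field
    ⟦_⟧                 : G.Carrier → H.Carrier
    isGroupHomomorphism : IsGroupHomomorphism ⟦_⟧
    continuous          : Continuous G.topology H.topology ⟦_⟧

_≗ʰ_ : {G H : TopologicalGroup ℓ} → Rel (ContinuousHom G H) ℓ
_≗ʰ_ {G = G} {H} φ ψ = ∀ x → ContinuousHom.⟦ φ ⟧ x ≈ ContinuousHom.⟦ ψ ⟧ x
  where open TopologicalGroup H using (_≈_)

FactorsThrough : {G B K : TopologicalGroup ℓ} →
                 ContinuousHom G B → ContinuousHom G K → Pred (ContinuousHom B K) ℓ
FactorsThrough {K = K} φ ψ χ =
  ∀ g → ContinuousHom.⟦ χ ⟧ (ContinuousHom.⟦ φ ⟧ g) ≈ ContinuousHom.⟦ ψ ⟧ g
  where open TopologicalGroup K using (_≈_)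

record IsBohrCompactification {G B : TopologicalGroup ℓ} (φ : ContinuousHom G B) : Set (suc (suc ℓ)) where
  field
    isCompactGroup : IsCompactGroup B
    universal      : ∀ {K : TopologicalGroup ℓ} → IsCompactGroup K → (ψ : ContinuousHom G K) →
                     ∃! (_≗ʰ_ {G = B} {K}) (FactorsThrough {G = G} {B} {K} φ ψ)

{-# OPTIONS --safe #-}

-- The universal property, applied to the closure of φ(G), shows that φ(G) is
-- dense. Roelcke precompactness makes φ nearly open: if G = VFV with F finite
-- and V a small neighbourhood of 1, then near the identity of B only those f
-- with 1 in the closure of φ(VfV) matter. Compact groups have arbitrarily small
-- conjugation-invariant neighbourhoods of 1, so for these f the point φ(f) is
-- in the closure of φ(V⁻¹V⁻¹), and φ(VfV) is in the closure of φ of a small set.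
-- Now fix b in B. The maps φ and bφ are continuous, nearly open and have dense
-- image, so one can alternately shrink open sets V and W of G, keeping the
-- interiors of the closures of φ(V) and bφ(W) from becoming disjoint. By
-- completeness V and W shrink to points g and h; then φ(g) = bφ(h), because B
-- is Hausdorff, and b = φ(gh⁻¹).
module Submission where

open import Defs
open import Axiom.ExcludedMiddle using (ExcludedMiddle)
open import Function.Definitions using (Surjective)
open import Algebra.Bundles using (Group; RawGroup)
import Algebra.Morphism.Construct.Composition as Composition
import Algebra.Morphism.Construct.Identity as Identity
import Algebra.Morphism.GroupMonomorphism as GroupMonomorphism
open import Algebra.Morphism.Structures using (IsGroupMonomorphism; module GroupMorphisms)
import Algebra.Properties.Group as GroupProperties
open import Data.Empty using (⊥-elim)
open import Data.Integer.Base as ℤ using (+_; +<+; +≤+)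
open import Data.List.Base using (List; []; _∷_; mapMaybe)
open import Data.List.Relation.Unary.Any using (Any; here; there)
open import Data.Nat.Base as ℕ using (ℕ; z≤n; s≤s)
open import Data.Nat.Coprimality using (1-coprimeTo)
import Data.Nat.Properties as ℕ
open import Data.Product using (Σ-syntax; ∃-syntax; _×_; _,_; proj₁; proj₂)
open import Data.Rational.Base as ℚ using (ℚ; 0ℚ; ½; mkℚ; *<*; *≤*)
import Data.Rational.Properties as ℚ
open import Data.Sum using (_⊎_; inj₁; inj₂; isInj₁)
open import Data.Unit.Polymorphic using (tt)
open import Function.Base using (_∘_; id)
open import Function.Metric.Structures using (IsGeneralMetric)
open import Level using (Level; Lift; lift; lower; suc)
open import Relation.Binary.Bundles using (Setoid)
open import Relation.Binary.PropositionalEquality as ≡ using (_≡_)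
import Relation.Binary.Reasoning.Setoid as SetoidReasoning
open import Relation.Nullary using (¬_; yes; no)
open import Relation.Nullary.Decidable using (True; toWitness; fromWitness; decidable-stable)
open import Relation.Unary using (Pred; _∈_; _⊆_; _≐_; _∩_; _⊢_; ⋃; Satisfiable)
open import Relation.Unary.Polymorphic using (U)

private
  variable
    ℓ : Level

-- Convergence in complete metric spaces

½-pos : ∀ {q} → 0ℚ ℚ.< q → 0ℚ ℚ.< ½ ℚ.* q
½-pos {q} 0<q = ℚ.positive⁻¹ (½ ℚ.* q) {{ℚ.pos*pos⇒pos ½ q {{ℚ.positive 0<q}}}}

½+½ : ∀ q → ½ ℚ.* q ℚ.+ ½ ℚ.* q ≡ q
½+½ q = ≡.trans (≡.sym (ℚ.*-distribʳ-+ q ½ ½)) (ℚ.*-identityˡ q)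

fromℚ : ℚ → ℝ
fromℚ q = record
  { seq    = λ _ → q
  ; cauchy = λ {ε} 0<ε → 0 , λ _ _ → ≡.subst (ℚ._< ε) (≡.sym (≡.cong ℚ.∣_∣ (ℚ.+-inverseʳ q))) 0<ε
  }

fromℚ-pos : ∀ {q} → 0ℚ ℚ.< q → 0ᴿ <ᴿ fromℚ q
fromℚ-pos {q} 0<q = ½ ℚ.* q , ½-pos 0<q , 0 , λ _ → begin-strict
  0ℚ ℚ.+ ½ ℚ.* q        <⟨ ℚ.+-monoˡ-< (½ ℚ.* q) (½-pos 0<q) ⟩
  ½ ℚ.* q ℚ.+ ½ ℚ.* q   ≡⟨ ½+½ q ⟩
  q                     ∎
  where open ℚ.≤-Reasoning

<-fromℚ-mono : ∀ x p q → p ℚ.≤ q → x <ᴿ fromℚ p → x <ᴿ fromℚ q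
<-fromℚ-mono x p q p≤q (δ , 0<δ , N , lt) = δ , 0<δ , N , λ n≥N → ℚ.<-≤-trans (lt n≥N) p≤q

≤-<-trans : ∀ x y z → x ≤ᴿ y → y <ᴿ z → x <ᴿ z
≤-<-trans x y z x≤y (δ , 0<δ , N , y<z) with x≤y (½-pos 0<δ)
... | M , x<y = ½ ℚ.* δ , ½-pos 0<δ , M ℕ.⊔ N , λ {n} n≥ → begin-strict
  seq x n ℚ.+ ½ ℚ.* δ
    <⟨ ℚ.+-monoˡ-< (½ ℚ.* δ) (x<y (ℕ.m⊔n≤o⇒m≤o M N n≥)) ⟩
  (seq y n ℚ.+ ½ ℚ.* δ) ℚ.+ ½ ℚ.* δ
    ≡⟨ ℚ.+-assoc (seq y n) (½ ℚ.* δ) (½ ℚ.* δ) ⟩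
  seq y n ℚ.+ (½ ℚ.* δ ℚ.+ ½ ℚ.* δ)
    ≡⟨ ≡.cong (seq y n ℚ.+_) (½+½ δ) ⟩
  seq y n ℚ.+ δ
    <⟨ y<z (ℕ.m⊔n≤o⇒n≤o M N n≥) ⟩
  seq z n ∎
  where open ℚ.≤-Reasoning

-- The first hypothesis is `y <ᴿ r` with its rational gap `q` exposed, so that the gap can bound
-- `z`.
+-<-fromℚ : ∀ y z r q → (∃[ N ] ∀ {n} → N ℕ.≤ n → seq y n ℚ.+ q ℚ.< seq r n) →
            z <ᴿ fromℚ q → (y +ᴿ z) <ᴿ r
+-<-fromℚ y z r q (M , y<r) (δ , 0<δ , N , z<q) = δ , 0<δ , M ℕ.⊔ N , λ {n} n≥ → begin-strict
  (seq y n ℚ.+ seq z n) ℚ.+ δ   ≡⟨ ℚ.+-assoc (seq y n) (seq z n) δ ⟩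
  seq y n ℚ.+ (seq z n ℚ.+ δ)   <⟨ ℚ.+-monoʳ-< (seq y n) (z<q (ℕ.m⊔n≤o⇒n≤o M N n≥)) ⟩
  seq y n ℚ.+ q                 <⟨ y<r (ℕ.m⊔n≤o⇒m≤o M N n≥) ⟩
  seq r n                       ∎
  where open ℚ.≤-Reasoning

1/[1+_] : ℕ → ℚ
1/[1+ n ] = mkℚ (+ 1) n (1-coprimeTo (ℕ.suc n))

1/[1+n]-pos : ∀ n → 0ℚ ℚ.< 1/[1+ n ]
1/[1+n]-pos n = *<* (+<+ (s≤s z≤n))

archimedean : ∀ {q} → 0ℚ ℚ.< q → ∃[ N ] ∀ {n} → N ℕ.≤ n → 1/[1+ n ] ℚ.≤ q
archimedean {mkℚ (+ ℕ.suc p) d _} _ = d , λ {n} d≤n → *≤* (+≤+ (begin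
  1 ℕ.* ℕ.suc d           ≤⟨ ℕ.*-mono-≤ (s≤s (z≤n {p})) (s≤s d≤n) ⟩
  ℕ.suc p ℕ.* ℕ.suc n     ∎))
  where open ℕ.≤-Reasoning
archimedean {mkℚ (+ 0) d _} (*<* (+<+ ()))
archimedean {mkℚ (ℤ.-[1+ p ]) d _} (*<* ())

-- A strategy for a player who shrinks open sets around points chosen by an
-- opponent and thereby forces every play to converge.
record ConvergenceStrategy {S : Setoid ℓ ℓ} (𝒯 : Topology S) : Set (suc ℓ) where
  open Setoid S using (Carrier)
  open Topology 𝒯 using (Open)
  field
    nbhd      : ℕ → Carrier → Pred Carrier ℓ
    nbhd-open : ∀ n x → Open (nbhd n x)
    ∈-nbhd    : ∀ n x → x ∈ nbhd n x
    converges : ∀ (x : ℕ → Carrier) (W : ℕ → Pred Carrier ℓ) →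
                (∀ n → x n ∈ W n) → (∀ n → W n ⊆ nbhd n (x n)) → (∀ n → W (ℕ.suc n) ⊆ W n) →
                ∃[ z ] ∀ {V} → Open V → z ∈ V → ∃[ N ] ∀ {n} → N ℕ.≤ n → W n ⊆ V

module _ {S : Setoid ℓ ℓ} (𝒯 : Topology S) where
  open Setoid S using (Carrier) renaming (refl to ≈-refl)
  open Topology 𝒯 using (Open)

  decreasing : (W : ℕ → Pred Carrier ℓ) → (∀ n → W (ℕ.suc n) ⊆ W n) →
               ∀ {m n} → m ℕ.≤ n → W n ⊆ W m
  decreasing W W↓ m≤n = go (ℕ.≤⇒≤′ m≤n)
    where
    go : ∀ {m n} → m ℕ.≤′ n → W n ⊆ W m
    go ℕ.≤′-refl                     p = p
    go {n = ℕ.suc n} (ℕ.≤′-step m≤n) p = go m≤n (W↓ n p)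

  module _ (d : Carrier → Carrier → ℝ) (d-metric : IsMetric 𝒯 d) where
    open IsGeneralMetric d-metric using (cong; ≈⇒0; sym; triangle)

    triangle-< : ∀ x y z r q → (∃[ N ] ∀ {n} → N ℕ.≤ n → seq (d x y) n ℚ.+ q ℚ.< seq r n) →
                 d y z <ᴿ fromℚ q → d x z <ᴿ r
    triangle-< x y z r q xy<r yz<q =
      ≤-<-trans (d x z) (d x y +ᴿ d y z) r (triangle x y z) (+-<-fromℚ (d x y) (d y z) r q xy<r yz<q)

    sym-< : ∀ x y r → d x y <ᴿ r → d y x <ᴿ r
    sym-< x y r = ≤-<-trans (d y x) (d x y) r (proj₁ (sym y x))

    -- Here `q` is the exposed gap of `0ᴿ <ᴿ r`: two steps shorter than `½ * q` stay below `r`, and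
    -- only rational radii are ever halved.
    ½-ball : ∀ x y z r q → (∃[ N ] ∀ {n} → N ℕ.≤ n → 0ℚ ℚ.+ q ℚ.< seq r n) →
             d x y <ᴿ fromℚ (½ ℚ.* q) → d x z <ᴿ fromℚ (½ ℚ.* q) → d y z <ᴿ r
    ½-ball x y z r q (M , q<r) xy< xz< =
      triangle-< y x z r (½ ℚ.* q) (lemma (sym-< x y (fromℚ (½ ℚ.* q)) xy<)) xz<
      where
      lemma : d y x <ᴿ fromℚ (½ ℚ.* q) →
              ∃[ N ] ∀ {n} → N ℕ.≤ n → seq (d y x) n ℚ.+ ½ ℚ.* q ℚ.< seq r n
      lemma (δ , 0<δ , N , yx<) = M ℕ.⊔ N , λ {n} n≥ → begin-strict
        seq (d y x) n ℚ.+ ½ ℚ.* q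
          ≡⟨ ≡.cong (ℚ._+ ½ ℚ.* q) (ℚ.+-identityʳ (seq (d y x) n)) ⟨
        (seq (d y x) n ℚ.+ 0ℚ) ℚ.+ ½ ℚ.* q
          <⟨ ℚ.+-monoˡ-< (½ ℚ.* q) (ℚ.+-monoʳ-< (seq (d y x) n) 0<δ) ⟩
        (seq (d y x) n ℚ.+ δ) ℚ.+ ½ ℚ.* q
          <⟨ ℚ.+-monoˡ-< (½ ℚ.* q) (yx< (ℕ.m⊔n≤o⇒n≤o M N n≥)) ⟩
        ½ ℚ.* q ℚ.+ ½ ℚ.* q
          ≡⟨ ≡.trans (½+½ q) (≡.sym (ℚ.+-identityˡ q)) ⟩
        0ℚ ℚ.+ q
          <⟨ q<r (ℕ.m⊔n≤o⇒m≤o M N n≥) ⟩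
        seq r n ∎
        where open ℚ.≤-Reasoning

    -- `MetricOpen` speaks of predicates of level `ℓ`, while `_<ᴿ_` has level zero; hence `Lift`.
    Ball : Carrier → ℚ → Pred Carrier ℓ
    Ball x q y = Lift ℓ (d x y <ᴿ fromℚ q)

    centre∈Ball : ∀ x {q} → 0ℚ ℚ.< q → x ∈ Ball x q
    centre∈Ball x {q} 0<q = lift (≤-<-trans (d x x) 0ᴿ (fromℚ q) (proj₁ (≈⇒0 ≈-refl)) (fromℚ-pos 0<q))

    Ball-open : ∀ x q → MetricOpen 𝒯 d (Ball x q)
    Ball-open x q =
      (λ {y} {z} y≈z (lift xy<q) →
        lift (≤-<-trans (d x z) (d x y) (fromℚ q) (proj₂ (cong ≈-refl y≈z)) xy<q)) ,
      -- The slack `δ` in `d x y < q` is the radius of a ball about `y` inside `Ball x q`.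
      λ {y} (lift (δ , 0<δ , xy<q)) →
        fromℚ δ , fromℚ-pos 0<δ , λ {z} yz<δ → lift (triangle-< x y z (fromℚ q) δ xy<q yz<δ)

  -- The `n`-th chosen point is answered by its ball of radius `1/(n+1)`. Since the sets decrease,
  -- later points stay in that ball; so the points form a Cauchy sequence, and completeness gives
  -- the limit.
  completelyMetrizable⇒strategy : CompletelyMetrizable 𝒯 → ConvergenceStrategy 𝒯
  completelyMetrizable⇒strategy (d , d-metric , induces , complete) = record
    { nbhd      = nbhd
    ; nbhd-open = λ n x → proj₂ (induces (nbhd n x)) (Ball-open d d-metric x 1/[1+ n ])
    ; ∈-nbhd    = λ n x → centre∈Ball d d-metric x (1/[1+n]-pos n)
    ; converges = converges
    }
    where
    nbhd : ℕ → Carrier → Pred Carrier ℓ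
    nbhd n x = Ball d d-metric x 1/[1+ n ]

    converges : ∀ (x : ℕ → Carrier) (W : ℕ → Pred Carrier ℓ) →
                (∀ n → x n ∈ W n) → (∀ n → W n ⊆ nbhd n (x n)) → (∀ n → W (ℕ.suc n) ⊆ W n) →
                ∃[ z ] ∀ {V} → Open V → z ∈ V → ∃[ N ] ∀ {n} → N ℕ.≤ n → W n ⊆ V
    converges x W x∈W W⊆nbhd W↓ = z , absorbed
      where
      small : ∀ q n {y} → 1/[1+ n ] ℚ.≤ q → y ∈ W n → d (x n) y <ᴿ fromℚ q
      small q n {y} le y∈W = <-fromℚ-mono (d (x n) y) 1/[1+ n ] q le (lower (W⊆nbhd n y∈W))

      x-cauchy : CauchySequence 𝒯 d x
      x-cauchy {r} (q , 0<q , q<r) with archimedean (½-pos 0<q)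
      ... | N , small-radius = N , λ {m} {n} N≤m N≤n →
        ½-ball d d-metric (x N) (x m) (x n) r q q<r (near N≤m) (near N≤n)
        where
        near : ∀ {m} → N ℕ.≤ m → d (x N) (x m) <ᴿ fromℚ (½ ℚ.* q)
        near {m} N≤m = small (½ ℚ.* q) N (small-radius ℕ.≤-refl) (decreasing W W↓ N≤m (x∈W m))

      limit : ∃[ z ] ConvergesTo 𝒯 d x z
      limit = complete x (λ {r} → x-cauchy {r})

      z = proj₁ limit

      absorbed : ∀ {V} → Open V → z ∈ V → ∃[ N ] ∀ {n} → N ℕ.≤ n → W n ⊆ V
      absorbed {V} V-open z∈V with proj₂ (proj₁ (induces V) V-open) z∈V
      ... | r , (q , 0<q , q<r) , ball⊆V
        with archimedean (½-pos 0<q) | proj₂ limit {fromℚ (½ ℚ.* q)} (fromℚ-pos (½-pos 0<q))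
      -- From this index on, `W n` is within `½ * q` of `x n`, and `x n` is within `½ * q` of `z`.
      ... | M , small-radius | N , near-z = M ℕ.⊔ N , λ {n} n≥ {y} y∈W →
        ball⊆V (½-ball d d-metric (x n) z y r q q<r (near-z (ℕ.m⊔n≤o⇒n≤o M N n≥))
                       (small (½ ℚ.* q) n (small-radius (ℕ.m⊔n≤o⇒m≤o M N n≥)) y∈W))

-- Adherent points and near openness

module _ {A : Set ℓ} {T : Setoid ℓ ℓ} (𝒯 : Topology T) (f : A → Setoid.Carrier T) where
  open Setoid T using (Carrier)
  open Topology 𝒯 using (Open)

  Adherent : Pred A ℓ → Pred Carrier (suc ℓ)
  Adherent W y = ∀ P → Open P → y ∈ P → ∃[ w ] w ∈ W × f w ∈ P

  Separated : Pred A ℓ → Pred Carrier (suc ℓ)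
  Separated W y = ∃[ P ] Open P × y ∈ P × (∀ {w} → w ∈ W → ¬ f w ∈ P)

  adherent-or-separated : (∀ {a} → ExcludedMiddle a) → ∀ W y → Adherent W y ⊎ Separated W y
  adherent-or-separated em W y with em {P = Separated W y}
  ... | yes sep = inj₂ sep
  ... | no ¬sep = inj₁ λ P P-open y∈P → decidable-stable em λ ¬meets →
    ¬sep (P , P-open , y∈P , λ w∈W fw∈P → ¬meets (_ , w∈W , fw∈P))

module _ {S T : Setoid ℓ ℓ} (𝒮 : Topology S) (𝒯 : Topology T) where
  private
    module 𝒮 = Topology 𝒮
    module 𝒯 = Topology 𝒯

  -- `f x` is interior to the closure of `f(W)`, not necessarily to `f(W)` itself; this is the
  -- almost openness of Banach's open mapping theorem.
  NearlyOpen : (Setoid.Carrier S → Setoid.Carrier T) → Set (suc ℓ)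
  NearlyOpen f = ∀ {W x} → 𝒮.Open W → x ∈ W →
    ∃[ O ] 𝒯.Open O × f x ∈ O × O ⊆ Adherent 𝒯 f W

module _ {S : Setoid ℓ ℓ} (𝒯 : Topology S) where
  open Setoid S using (Carrier)
  open Topology 𝒯

  locally-open : ∀ {V} → (∀ x → x ∈ V → ∃[ O ] Open O × x ∈ O × O ⊆ V) → Open V
  locally-open {V} local = open-≐
    ((λ ((x , x∈V) , y∈O) → proj₂ (proj₂ (proj₂ (local x x∈V))) y∈O) ,
     λ {x} x∈V → (x , x∈V) , proj₁ (proj₂ (proj₂ (local x x∈V))))
    -- The union is indexed by the points of `V`; the family of all open subsets of `V` would have
    -- too high a level.
    (open-⋃ (Σ[ x ∈ Carrier ] x ∈ V) (λ (x , x∈V) → proj₁ (local x x∈V))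
            (λ (x , x∈V) → proj₁ (proj₂ (local x x∈V))))

  -- `Q` is arbitrary so that `Any Q is` can be the witness of a finite subcover as well as
  -- membership in a list up to `_≈_`.
  finite-intersection : ∀ {I : Set ℓ} (N : I → Pred Carrier ℓ) x →
    (∀ i → Open (N i)) → (∀ i → x ∈ N i) → (is : List I) →
    ∃[ O ] Open O × x ∈ O × (∀ {Q : Pred I ℓ} → Any Q is → ∃[ i ] Q i × O ⊆ N i)
  finite-intersection N x N-open x∈N []       = U , open-full , tt , λ ()
  finite-intersection N x N-open x∈N (i ∷ is) with finite-intersection N x N-open x∈N is
  ... | O , O-open , x∈O , sub = N i ∩ O , open-∩ (N-open i) O-open , (x∈N i , x∈O) , λ
    { (here q)  → i , q , proj₁
    ; (there a) → let j , q , O⊆ = sub a in j , q , λ (_ , y∈O) → O⊆ y∈O }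

-- Coincidences of nearly open maps

module _ {S T : Setoid ℓ ℓ} (𝒮 : Topology S) (𝒯 : Topology T)
         (strategy : ConvergenceStrategy 𝒮) where
  private
    module 𝒮 = Topology 𝒮
    module 𝒯 = Topology 𝒯
    X = Setoid.Carrier S
    Y = Setoid.Carrier T
  open ConvergenceStrategy strategy

  -- `O` witnesses that the interiors of the closures of `f(V)` and `g(W)` meet, which is the
  -- invariant of the play.
  record Position (f g : X → Y) (V W : Pred X ℓ) : Set (suc ℓ) where
    field
      V-open : 𝒮.Open V
      W-open : 𝒮.Open W
      O      : Pred Y ℓ
      O-open : 𝒯.Open O
      O-sat  : Satisfiable O
      O⊆clfV : O ⊆ Adherent 𝒯 f V
      O⊆clgW : O ⊆ Adherent 𝒯 g W

  record Stage (f g : X → Y) (n : ℕ) : Set (suc ℓ) where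
    field
      v w      : X
      V W      : Pred X ℓ
      v∈V      : v ∈ V
      w∈W      : w ∈ W
      V⊆nbhd   : V ⊆ nbhd n v
      W⊆nbhd   : W ⊆ nbhd n w
      position : Position f g V W

  -- A point of `O` is adherent to `f(V)`, so some `f v` with `v` in `V` lies in `O`. Near openness
  -- at `v` gives `O′` around `f v` for the shrunken set, and `O ∩ O′` still contains `f v`. The two
  -- maps exchange roles in the result, so two half-turns make a turn.
  half-turn : ∀ {f g} n → NearlyOpen 𝒮 𝒯 f → ∀ {V W} → Position f g V W →
    ∃[ v ] ∃[ V′ ] v ∈ V′ × V′ ⊆ nbhd n v × V′ ⊆ V × Position g f W V′
  half-turn {f} {g} n f-nearlyOpen {V} {W} p
    with O⊆clfV (proj₂ O-sat) O O-open (proj₂ O-sat)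
    where open Position p
  ... | v , v∈V , fv∈O
    with f-nearlyOpen {V ∩ nbhd n v} {v} (𝒮.open-∩ (Position.V-open p) (nbhd-open n v))
                      (v∈V , ∈-nbhd n v)
  ... | O′ , O′-open , fv∈O′ , O′⊆ =
    v , V ∩ nbhd n v , (v∈V , ∈-nbhd n v) , proj₂ , proj₁ , record
      { V-open = W-open
      ; W-open = 𝒮.open-∩ V-open (nbhd-open n v)
      ; O      = O ∩ O′
      ; O-open = 𝒯.open-∩ O-open O′-open
      ; O-sat  = f v , fv∈O , fv∈O′
      ; O⊆clfV = λ (y∈O , _) → O⊆clgW y∈O
      ; O⊆clgW = λ (_ , y∈O′) → O′⊆ y∈O′
      }
    where open Position p

  turn : ∀ {f g} → NearlyOpen 𝒮 𝒯 f → NearlyOpen 𝒮 𝒯 g → ∀ n {V W} → Position f g V W →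
         Σ[ s ∈ Stage f g n ] Stage.V s ⊆ V × Stage.W s ⊆ W
  turn f-no g-no n p with half-turn n f-no p
  ... | v , V′ , v∈ , V′⊆nbhd , V′⊆V , p′ with half-turn n g-no p′
  ... | w , W′ , w∈ , W′⊆nbhd , W′⊆W , p″ = record
    { v = v ; w = w ; V = V′ ; W = W′ ; v∈V = v∈ ; w∈W = w∈
    ; V⊆nbhd = V′⊆nbhd ; W⊆nbhd = W′⊆nbhd ; position = p″ } , V′⊆V , W′⊆W

  coincidence : (∀ {a} → ExcludedMiddle a) → Hausdorff 𝒯 → ∀ {f g} →
    Continuous 𝒮 𝒯 f → Continuous 𝒮 𝒯 g → NearlyOpen 𝒮 𝒯 f → NearlyOpen 𝒮 𝒯 g →
    Y → (∀ y → Adherent 𝒯 f U y) → (∀ y → Adherent 𝒯 g U y) →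
    ∃[ v ] ∃[ w ] Setoid._≈_ T (f v) (g w)
  coincidence em hausdorff {f} {g} f-cont g-cont f-no g-no y f-dense g-dense =
    proj₁ v-limit , proj₁ w-limit , decidable-stable em apart-absurd
    where
    stage : ∀ n → Stage f g n
    -- Density puts every point in both closures, so the play opens with the whole space on both
    -- sides; `y` makes `O = U` nonempty.
    stage ℕ.zero    = proj₁ (turn f-no g-no 0 record
      { V-open = 𝒮.open-full
      ; W-open = 𝒮.open-full
      ; O      = U
      ; O-open = 𝒯.open-full
      ; O-sat  = y , tt
      ; O⊆clfV = λ {y} _ → f-dense y
      ; O⊆clgW = λ {y} _ → g-dense y
      })
    stage (ℕ.suc n) = proj₁ (turn f-no g-no (ℕ.suc n) (Stage.position (stage n)))

    module Stageₙ n = Stage (stage n)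

    v-limit = converges Stageₙ.v Stageₙ.V Stageₙ.v∈V (λ n → Stageₙ.V⊆nbhd n)
      λ n → proj₁ (proj₂ (turn f-no g-no (ℕ.suc n) (Stageₙ.position n)))
    w-limit = converges Stageₙ.w Stageₙ.W Stageₙ.w∈W (λ n → Stageₙ.W⊆nbhd n)
      λ n → proj₂ (proj₂ (turn f-no g-no (ℕ.suc n) (Stageₙ.position n)))

    apart-absurd : ¬ ¬ Setoid._≈_ T (f (proj₁ v-limit)) (g (proj₁ w-limit))
    apart-absurd f≉g with hausdorff _ _ f≉g
    ... | P , Q , P-open , Q-open , fv∈P , gw∈Q , P⊥Q
      with proj₂ v-limit (f-cont P-open) fv∈P | proj₂ w-limit (g-cont Q-open) gw∈Q
    -- At a stage past both indices, some `f a` lies in `O` and in `P`. It is adherent to `g(W)`, so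
    -- `P` also contains some `g b` with `b` in `W`, and this `g b` lies in `Q`.
    ... | M , V⊆P | N , W⊆Q with O⊆clfV (proj₂ O-sat) O O-open (proj₂ O-sat)
      where open Position (Stageₙ.position (M ℕ.⊔ N))
    ... | a , a∈V , fa∈O
      with Position.O⊆clgW (Stageₙ.position (M ℕ.⊔ N)) fa∈O P P-open (V⊆P (ℕ.m≤m⊔n M N) a∈V)
    ... | b , b∈W , gb∈P = P⊥Q (gb∈P , W⊆Q (ℕ.m≤n⊔m M N) b∈W)

-- Neighbourhoods in topological groups

module _ (H : TopologicalGroup ℓ) where
  open TopologicalGroup H
  open GroupProperties group using (ε⁻¹≈ε)

  ∙-box : ∀ {V x y} → Open V → x ∙ y ∈ V →
    ∃[ O ] ∃[ P ] Open O × Open P × x ∈ O × y ∈ P × (∀ {a b} → a ∈ O → b ∈ P → a ∙ b ∈ V)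
  ∙-box V-open xy∈V with proj₂ (∙-continuous V-open) xy∈V
  ... | O , P , O-open , P-open , (x∈O , y∈P) , sub =
    O , P , O-open , P-open , x∈O , y∈P , λ a∈O b∈P → sub (a∈O , b∈P)

  ∙-continuousˡ : ∀ a → Continuous topology topology (a ∙_)
  ∙-continuousˡ a {V} V-open = locally-open topology λ x ax∈V →
    let O , P , _ , P-open , a∈O , x∈P , sub = ∙-box V-open ax∈V in P , P-open , x∈P , sub a∈O

  ∙-continuousʳ : ∀ a → Continuous topology topology (_∙ a)
  ∙-continuousʳ a {V} V-open = locally-open topology λ x xa∈V →
    let O , P , O-open , _ , x∈O , a∈P , sub = ∙-box V-open xa∈V in
    O , O-open , x∈O , λ y∈O → sub y∈O a∈P

  cube-nbhd : ∀ {M} → Open M → ε ∈ M →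
    ∃[ V ] Open V × ε ∈ V × (∀ {a b c} → a ∈ V → b ∈ V → c ∈ V → (a ∙ b) ∙ c ∈ M)
  cube-nbhd {M} M-open ε∈M
    with ∙-box {x = ε} {y = ε} M-open (open-≈ M-open (sym (identityˡ ε)) ε∈M)
  ... | O , P , O-open , P-open , ε∈O , ε∈P , OP⊆M
    with ∙-box {x = ε} {y = ε} O-open (open-≈ O-open (sym (identityˡ ε)) ε∈O)
  ... | Q , R , Q-open , R-open , ε∈Q , ε∈R , QR⊆O =
    P ∩ (Q ∩ R) , open-∩ P-open (open-∩ Q-open R-open) , (ε∈P , ε∈Q , ε∈R) ,
    λ (_ , a∈Q , _) (_ , _ , b∈R) (c∈P , _) → OP⊆M (QR⊆O a∈Q b∈R) c∈P

  inverse-nbhd : ∀ {M} → Open M → ε ∈ M → Open (_⁻¹ ⊢ M) × ε ∈ (_⁻¹ ⊢ M)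
  inverse-nbhd M-open ε∈M = ⁻¹-continuous M-open , open-≈ M-open (sym ε⁻¹≈ε) ε∈M

  -- Prepares for the elements `(vu)⁻¹ = u⁻¹v⁻¹` with `u` and `v` in `V`, which have to land in `M`.
  quotient-nbhd : ∀ {M} → Open M → ε ∈ M →
    ∃[ V ] Open V × ε ∈ V × V ⊆ M × (∀ {a b} → a ∈ V → b ∈ V → a ⁻¹ ∙ b ⁻¹ ∈ M)
  quotient-nbhd {M} M-open ε∈M
    with ∙-box {x = ε} {y = ε} M-open (open-≈ M-open (sym (identityˡ ε)) ε∈M)
  ... | O , P , O-open , P-open , ε∈O , ε∈P , OP⊆M
    with inverse-nbhd O-open ε∈O | inverse-nbhd P-open ε∈P
  ... | O⁻¹-open , ε∈O⁻¹ | P⁻¹-open , ε∈P⁻¹ =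
    M ∩ ((_⁻¹ ⊢ O) ∩ (_⁻¹ ⊢ P)) , open-∩ M-open (open-∩ O⁻¹-open P⁻¹-open) ,
    (ε∈M , ε∈O⁻¹ , ε∈P⁻¹) , proj₁ , λ (_ , a∈ , _) (_ , _ , b∈) → OP⊆M a∈ b∈

  -- Joint continuity of `(c, n) ↦ cnc⁻¹` at `(b, ε)`, the local half of the compactness argument in
  -- `conjugation-nbhd`.
  conjugation-box : ∀ {M} → Open M → ε ∈ M → ∀ b →
    ∃[ N ] ∃[ P ] Open N × Open P × ε ∈ N × b ∈ P ×
    (∀ {n c} → n ∈ N → c ∈ P → (c ∙ n) ∙ c ⁻¹ ∈ M)
  conjugation-box M-open ε∈M b
    with ∙-box {x = b ∙ ε} {y = b ⁻¹} M-open
           (open-≈ M-open (sym (trans (∙-congʳ (identityʳ b)) (inverseʳ b))) ε∈M)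
  ... | O , Q , O-open , Q-open , bε∈O , b⁻¹∈Q , OQ⊆M
    with ∙-box {x = b} {y = ε} O-open bε∈O
  ... | P , N , P-open , N-open , b∈P , ε∈N , PN⊆O =
    N , P ∩ (_⁻¹ ⊢ Q) , N-open , open-∩ P-open (⁻¹-continuous Q-open) , ε∈N , (b∈P , b⁻¹∈Q) ,
    λ n∈N (c∈P , c⁻¹∈Q) → OQ⊆M (PN⊆O c∈P n∈N) c⁻¹∈Q

  -- Tube argument: finitely many of the sets `P` cover the group, and `N` is the intersection of
  -- the matching neighbourhoods of the identity. `N` need not be invariant; the union of its
  -- conjugates is, and lies in `M`.
  conjugation-nbhd : Compact topology → ∀ {M} → Open M → ε ∈ M →
    ∃[ N ] Open N × ε ∈ N × (∀ b {n} → n ∈ N → (b ∙ n) ∙ b ⁻¹ ∈ M)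
  conjugation-nbhd compact {M} M-open ε∈M
    with compact Carrier (λ b → proj₁ (proj₂ (box b)))
                 (λ b → let _ , _ , _ , P-open , _ = box b in P-open)
                 (λ b → let _ , _ , _ , _ , _ , b∈P , _ = box b in b , b∈P)
    where box = conjugation-box M-open ε∈M
  ... | bs , cover
    with finite-intersection topology (λ b → proj₁ (box b)) ε
           (λ b → let _ , _ , N-open , _ = box b in N-open)
           (λ b → let _ , _ , _ , _ , ε∈N , _ = box b in ε∈N) bs
    where box = conjugation-box M-open ε∈M
  ... | N , N-open , ε∈N , sub = N , N-open , ε∈N , λ c n∈N →
    let b , c∈P , N⊆Nb = sub (cover c)
        _ , _ , _ , _ , _ , _ , conj = conjugation-box M-open ε∈M b
    in conj (N⊆Nb n∈N) c∈P

DenseImage : {G B : TopologicalGroup ℓ} → ContinuousHom G B → Set (suc ℓ)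
DenseImage {B = B} φ = ∀ b → Adherent (TopologicalGroup.topology B) (ContinuousHom.⟦ φ ⟧) U b

-- Near openness of homomorphisms from Roelcke-precompact groups

module _ (em : ∀ {a} → ExcludedMiddle a) {G B : TopologicalGroup ℓ} (φ : ContinuousHom G B) where
  private
    module G = TopologicalGroup G
    module B = TopologicalGroup B
    module Gᵖ = GroupProperties G.group
    module Bᵖ = GroupProperties B.group
  open ContinuousHom φ
  open GroupMorphisms G.rawGroup B.rawGroup using (module IsGroupHomomorphism)
  open IsGroupHomomorphism isGroupHomomorphism
    using () renaming (⟦⟧-cong to φ-cong; homo to φ-homo; ⁻¹-homo to φ-⁻¹)

  Adherentᵠ : Pred G.Carrier ℓ → Pred B.Carrier (suc ℓ)
  Adherentᵠ = Adherent B.topology ⟦_⟧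

  -- Choose `w` in `V` with `φ(w)` close to `φ(f)`; then `uwv` lies in `VVV` and `φ(uwv)` is close
  -- to `φ(ufv)`.
  translate-adherent : (V W : Pred G.Carrier ℓ) → (∀ {a b c} → a ∈ V → b ∈ V → c ∈ V → (a G.∙ b) G.∙ c ∈ W) →
    ∀ {u f v} → u ∈ V → v ∈ V → ⟦ f ⟧ ∈ Adherentᵠ V → ⟦ (u G.∙ f) G.∙ v ⟧ ∈ Adherentᵠ W
  translate-adherent V W VVV⊆W {u} {f} {v} u∈V v∈V f-adh P P-open ufv∈P
    with f-adh (λ b → (⟦ u ⟧ B.∙ b) B.∙ ⟦ v ⟧ ∈ P)
               (∙-continuousˡ B ⟦ u ⟧ (∙-continuousʳ B ⟦ v ⟧ P-open))
               (B.open-≈ P-open (φ-homo₃ u f v) ufv∈P)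
    where
    φ-homo₃ : ∀ x y z → ⟦ (x G.∙ y) G.∙ z ⟧ B.≈ (⟦ x ⟧ B.∙ ⟦ y ⟧) B.∙ ⟦ z ⟧
    φ-homo₃ x y z = B.trans (φ-homo _ z) (B.∙-congʳ (φ-homo x y))
  ... | w , w∈V , uwv∈P = (u G.∙ w) G.∙ v , VVV⊆W u∈V w∈V v∈V ,
    B.open-≈ P-open (B.sym (B.trans (φ-homo _ v) (B.∙-congʳ (φ-homo u w)))) uwv∈P

  -- If g = ufv is close to the identity in B, then so is its conjugate fvu,
  -- whence f is close to (vu)⁻¹ = u⁻¹v⁻¹.
  separated⇒avoids : Compact B.topology → (V W : Pred G.Carrier ℓ) →
    (∀ {a b} → a ∈ V → b ∈ V → a G.⁻¹ G.∙ b G.⁻¹ ∈ W) →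
    ∀ {f} → Separated B.topology ⟦_⟧ W ⟦ f ⟧ →
    ∃[ N ] B.Open N × B.ε ∈ N × (∀ {u v} → u ∈ V → v ∈ V → ¬ ⟦ (u G.∙ f) G.∙ v ⟧ ∈ N)
  separated⇒avoids compact V W V⁻¹V⁻¹⊆W {f} (M , M-open , f∈M , W∌M)
    with ∙-box B {x = B.ε} {y = ⟦ f ⟧} M-open (B.open-≈ M-open (B.sym (B.identityˡ ⟦ f ⟧)) f∈M)
  ... | O , P , O-open , _ , ε∈O , f∈P , OP⊆M
    with inverse-nbhd B O-open ε∈O
  ... | O⁻¹-open , ε∈O⁻¹
    with conjugation-nbhd B compact O⁻¹-open ε∈O⁻¹
  ... | N , N-open , ε∈N , conj = N , N-open , ε∈N , λ {u} {v} u∈V v∈V ufv∈N →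
    W∌M {u G.⁻¹ G.∙ v G.⁻¹} (V⁻¹V⁻¹⊆W u∈V v∈V)
        (B.open-≈ M-open (compute u v) (OP⊆M (conj ⟦ u G.⁻¹ ⟧ ufv∈N) f∈P))
    where
    cancel : ∀ u v → (((u G.⁻¹ G.∙ ((u G.∙ f) G.∙ v)) G.∙ (u G.⁻¹) G.⁻¹) G.⁻¹) G.∙ f
                     G.≈ u G.⁻¹ G.∙ v G.⁻¹
    cancel u v = begin
      (((u ⁻¹ ∙ ((u ∙ f) ∙ v)) ∙ (u ⁻¹) ⁻¹) ⁻¹) ∙ f
        ≈⟨ ∙-congʳ (⁻¹-cong (∙-cong (trans (∙-congˡ (assoc u f v)) (Gᵖ.\\-leftDividesʳ u (f ∙ v))) (Gᵖ.⁻¹-involutive u))) ⟩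
      (((f ∙ v) ∙ u) ⁻¹) ∙ f
        ≈⟨ ∙-congʳ (trans (Gᵖ.⁻¹-anti-homo-∙ (f ∙ v) u) (∙-congˡ (Gᵖ.⁻¹-anti-homo-∙ f v))) ⟩
      (u ⁻¹ ∙ (v ⁻¹ ∙ f ⁻¹)) ∙ f
        ≈⟨ ∙-congʳ (assoc (u ⁻¹) (v ⁻¹) (f ⁻¹)) ⟨
      ((u ⁻¹ ∙ v ⁻¹) ∙ f ⁻¹) ∙ f
        ≈⟨ Gᵖ.//-rightDividesˡ f (u ⁻¹ ∙ v ⁻¹) ⟩
      u ⁻¹ ∙ v ⁻¹ ∎
      where
      open G
      open SetoidReasoning G.setoid

    compute : ∀ u v →
      (((⟦ u G.⁻¹ ⟧ B.∙ ⟦ (u G.∙ f) G.∙ v ⟧) B.∙ ⟦ u G.⁻¹ ⟧ B.⁻¹) B.⁻¹) B.∙ ⟦ f ⟧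
      B.≈ ⟦ u G.⁻¹ G.∙ v G.⁻¹ ⟧
    compute u v = begin
      (((⟦ u G.⁻¹ ⟧ B.∙ ⟦ g ⟧) B.∙ ⟦ u G.⁻¹ ⟧ B.⁻¹) B.⁻¹) B.∙ ⟦ f ⟧
        ≈⟨ B.∙-congʳ (B.⁻¹-cong (B.∙-cong (φ-homo (u G.⁻¹) g) (φ-⁻¹ (u G.⁻¹)))) ⟨
      ((⟦ u G.⁻¹ G.∙ g ⟧ B.∙ ⟦ (u G.⁻¹) G.⁻¹ ⟧) B.⁻¹) B.∙ ⟦ f ⟧
        ≈⟨ B.∙-congʳ (B.⁻¹-cong (φ-homo (u G.⁻¹ G.∙ g) ((u G.⁻¹) G.⁻¹))) ⟨
      (⟦ (u G.⁻¹ G.∙ g) G.∙ (u G.⁻¹) G.⁻¹ ⟧ B.⁻¹) B.∙ ⟦ f ⟧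
        ≈⟨ B.∙-congʳ (φ-⁻¹ ((u G.⁻¹ G.∙ g) G.∙ (u G.⁻¹) G.⁻¹)) ⟨
      ⟦ ((u G.⁻¹ G.∙ g) G.∙ (u G.⁻¹) G.⁻¹) G.⁻¹ ⟧ B.∙ ⟦ f ⟧
        ≈⟨ φ-homo (((u G.⁻¹ G.∙ g) G.∙ (u G.⁻¹) G.⁻¹) G.⁻¹) f ⟨
      ⟦ (((u G.⁻¹ G.∙ g) G.∙ (u G.⁻¹) G.⁻¹) G.⁻¹) G.∙ f ⟧
        ≈⟨ φ-cong (cancel u v) ⟩
      ⟦ u G.⁻¹ G.∙ v G.⁻¹ ⟧ ∎
      where
      g = (u G.∙ f) G.∙ v
      open SetoidReasoning B.setoid

  -- Dichotomy on `φ(f)`. If it is in the closure of `φ(V)`, the image of the whole double coset is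
  -- absorbed and `N = U` will do; if not, some `N` misses that image and the claim is vacuous.
  double-coset-nbhd : Compact B.topology → (V V′ W : Pred G.Carrier ℓ) →
    (∀ {a b c} → a ∈ V → b ∈ V → c ∈ V → (a G.∙ b) G.∙ c ∈ W) →
    V′ ⊆ V → (∀ {a b} → a ∈ V′ → b ∈ V′ → a G.⁻¹ G.∙ b G.⁻¹ ∈ V) →
    ∀ f → ∃[ N ] B.Open N × B.ε ∈ N ×
      (∀ {u v} → u ∈ V′ → v ∈ V′ → ⟦ (u G.∙ f) G.∙ v ⟧ ∈ N → ⟦ (u G.∙ f) G.∙ v ⟧ ∈ Adherentᵠ W)
  double-coset-nbhd compact V V′ W VVV⊆W V′⊆V V′⁻¹V′⁻¹⊆V f
    with adherent-or-separated B.topology ⟦_⟧ em V ⟦ f ⟧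
  ... | inj₁ f-adh = U , B.open-full , tt , λ {u} {v} u∈ v∈ _ →
    translate-adherent V W VVV⊆W {u} {f} {v} (V′⊆V u∈) (V′⊆V v∈) f-adh
  ... | inj₂ f-sep =
    let N , N-open , ε∈N , avoids = separated⇒avoids compact V′ V V′⁻¹V′⁻¹⊆V {f} f-sep in
    N , N-open , ε∈N , λ {u} {v} u∈ v∈ ufv∈N → ⊥-elim (avoids {u} {v} u∈ v∈ ufv∈N)

  -- Finiteness of `F` lets one neighbourhood `O` serve all the double cosets `V′fV′`. A point of
  -- `O` is approximated by some `φ(g)` that is itself in `O`, and `g` belongs to one of these
  -- cosets.
  nearly-open-at-ε : Compact B.topology → RoelckePrecompact G → DenseImage {G = G} {B} φ →
    ∀ {W} → G.Open W → G.ε ∈ W → ∃[ O ] B.Open O × B.ε ∈ O × O ⊆ Adherentᵠ W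
  nearly-open-at-ε compact roelcke dense {W} W-open ε∈W
    with cube-nbhd G W-open ε∈W
  ... | V , V-open , ε∈V , VVV⊆W
    with quotient-nbhd G V-open ε∈V
  ... | V′ , V′-open , ε∈V′ , V′⊆V , V′⁻¹V′⁻¹⊆V
    with roelcke V′-open ε∈V′
  ... | F , V′FV′=G = O , O-open , ε∈O , O⊆
    where
    cell = double-coset-nbhd compact V V′ W VVV⊆W V′⊆V V′⁻¹V′⁻¹⊆V

    intersection = finite-intersection B.topology (λ f → proj₁ (cell f)) B.ε
      (λ f → proj₁ (proj₂ (cell f))) (λ f → proj₁ (proj₂ (proj₂ (cell f)))) F
    O      = proj₁ intersection
    O-open = proj₁ (proj₂ intersection)
    ε∈O    = proj₁ (proj₂ (proj₂ intersection))

    O⊆ : O ⊆ Adherentᵠ W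
    O⊆ {b} b∈O P P-open b∈P with dense b (O ∩ P) (B.open-∩ O-open P-open) (b∈O , b∈P)
    ... | g , _ , φg∈O , φg∈P with V′FV′=G g
    ... | u , f , v , u∈V′ , f∈F , v∈V′ , g≈ufv with proj₂ (proj₂ (proj₂ intersection)) f∈F
    -- `f` is in `F` only up to `_≈_`; the neighbourhood belongs to the actual entry `f′`, so `g` is
    -- rewritten with `f′`.
    ... | f′ , f≈f′ , O⊆N = proj₂ (proj₂ (proj₂ (cell f′))) {u} {v} u∈V′ v∈V′
      (O⊆N (B.open-≈ O-open φg≈ φg∈O)) P P-open (B.open-≈ P-open φg≈ φg∈P)
      where
      φg≈ : ⟦ g ⟧ B.≈ ⟦ (u G.∙ f′) G.∙ v ⟧
      φg≈ = φ-cong (G.trans g≈ufv (G.∙-congʳ (G.∙-congˡ f≈f′)))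

  -- Since `aφ(xw) = (aφ(x))φ(w)`, translating by `c = aφ(x)` moves near openness from the identity
  -- to `x`.
  translate-nearly-open : Compact B.topology → RoelckePrecompact G → DenseImage {G = G} {B} φ →
    ∀ a → NearlyOpen G.topology B.topology (λ g → a B.∙ ⟦ g ⟧)
  translate-nearly-open compact roelcke dense a {W} {x} W-open x∈W =
    translate (nearly-open-at-ε compact roelcke dense (∙-continuousˡ G x W-open)
                (G.open-≈ W-open (G.sym (G.identityʳ x)) x∈W))
    where
    c = a B.∙ ⟦ x ⟧

    translate : (∃[ O ] B.Open O × B.ε ∈ O × O ⊆ Adherentᵠ ((x G.∙_) ⊢ W)) →
      ∃[ O ] B.Open O × c ∈ O × O ⊆ Adherent B.topology (λ g → a B.∙ ⟦ g ⟧) W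
    translate (O , O-open , ε∈O , O⊆) =
      -- This is the translate `cO`, written as a preimage.
      (c B.⁻¹ B.∙_) ⊢ O , ∙-continuousˡ B (c B.⁻¹) O-open ,
      B.open-≈ O-open (B.sym (B.inverseˡ c)) ε∈O , λ {b} b∈ P P-open b∈P →
        let w , xw∈W , cw∈P = O⊆ b∈ ((c B.∙_) ⊢ P) (∙-continuousˡ B c P-open)
              (B.open-≈ P-open (B.sym (Bᵖ.\\-leftDividesˡ c b)) b∈P)
        in x G.∙ w , xw∈W ,
           B.open-≈ P-open (B.trans (B.assoc a ⟦ x ⟧ ⟦ w ⟧) (B.∙-congˡ (B.sym (φ-homo x w)))) cw∈P

  translate-dense : DenseImage {G = G} {B} φ → ∀ a b → Adherent B.topology (λ g → a B.∙ ⟦ g ⟧) U b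
  translate-dense dense a b P P-open b∈P =
    dense (a B.⁻¹ B.∙ b) ((a B.∙_) ⊢ P) (∙-continuousˡ B a P-open)
          (B.open-≈ P-open (B.sym (Bᵖ.\\-leftDividesˡ a b)) b∈P)

  dense⇒surjective : CompletelyMetrizable G.topology → RoelckePrecompact G → IsCompactGroup B →
    DenseImage {G = G} {B} φ → ∀ b → ∃[ g ] ⟦ g ⟧ B.≈ b
  dense⇒surjective metrizable roelcke (compact , hausdorff) dense b =
    let g , h , g≈bh = coincidence G.topology B.topology
          (completelyMetrizable⇒strategy G.topology metrizable) em hausdorff
          -- `φ` enters as its translate by `ε`, so that the lemmas on translates cover both maps.
          {λ g → B.ε B.∙ ⟦ g ⟧} {λ g → b B.∙ ⟦ g ⟧}
          (translate-continuous B.ε) (translate-continuous b)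
          (translate-nearly-open compact roelcke dense B.ε)
          (translate-nearly-open compact roelcke dense b)
          B.ε (translate-dense dense B.ε) (translate-dense dense b)
    in g G.∙ h G.⁻¹ , solve g h g≈bh
    where
    translate-continuous : ∀ a → Continuous G.topology B.topology (λ g → a B.∙ ⟦ g ⟧)
    translate-continuous a V-open = continuous (∙-continuousˡ B a V-open)

    solve : ∀ g h → B.ε B.∙ ⟦ g ⟧ B.≈ b B.∙ ⟦ h ⟧ → ⟦ g G.∙ h G.⁻¹ ⟧ B.≈ b
    solve g h g≈bh = begin
      ⟦ g G.∙ h G.⁻¹ ⟧             ≈⟨ B.trans (φ-homo g (h G.⁻¹)) (B.∙-congˡ (φ-⁻¹ h)) ⟩
      ⟦ g ⟧ B.∙ ⟦ h ⟧ B.⁻¹         ≈⟨ B.∙-congʳ (B.trans (B.sym (B.identityˡ ⟦ g ⟧)) g≈bh) ⟩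
      (b B.∙ ⟦ h ⟧) B.∙ ⟦ h ⟧ B.⁻¹ ≈⟨ Bᵖ.//-rightDividesʳ ⟦ h ⟧ b ⟩
      b                            ∎
      where open SetoidReasoning B.setoid

-- Closed subgroups

module _ (H : TopologicalGroup ℓ) (C : Pred (TopologicalGroup.Carrier H) ℓ) where
  open TopologicalGroup H

  record IsSubgroup : Set ℓ where
    field
      ε-closed  : ε ∈ C
      ∙-closed  : ∀ {x y} → x ∈ C → y ∈ C → x ∙ y ∈ C
      ⁻¹-closed : ∀ {x} → x ∈ C → x ⁻¹ ∈ C

  module _ (isSubgroup : IsSubgroup) where
    open IsSubgroup isSubgroup

    subgroup-raw : RawGroup ℓ ℓ
    subgroup-raw = record
      { Carrier = Σ[ x ∈ Carrier ] x ∈ C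
      ; _≈_     = λ (x , _) (y , _) → x ≈ y
      ; _∙_     = λ (x , x∈C) (y , y∈C) → x ∙ y , ∙-closed x∈C y∈C
      ; ε       = ε , ε-closed
      ; _⁻¹     = λ (x , x∈C) → x ⁻¹ , ⁻¹-closed x∈C
      }

    -- Equality in the subgroup ignores membership proofs, so the inclusion is injective by
    -- definition and the group laws of `H` pull back along it.
    inclusion-mono : IsGroupMonomorphism subgroup-raw rawGroup proj₁
    inclusion-mono = record
      { isGroupHomomorphism = record
        { isMonoidHomomorphism = record
          { isMagmaHomomorphism = record
            { isRelHomomorphism = record { cong = id }
            ; homo = λ _ _ → refl
            }
          ; ε-homo = refl
          }
        ; ⁻¹-homo = λ _ → refl
        }
      ; injective = id
      }

    subgroup-group : Group ℓ ℓ
    subgroup-group = record { isGroup = GroupMonomorphism.isGroup inclusion-mono isGroup }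

    subspace : Topology (Group.setoid subgroup-group)
    subspace = record
      { Open      = λ W → ∃[ V ] Open V × W ≐ (proj₁ ⊢ V)
      ; open-≈    = λ (V , V-open , W⊆V , V⊆W) x≈y x∈W → V⊆W (open-≈ V-open x≈y (W⊆V x∈W))
      ; open-≐    = λ (W⊆W′ , W′⊆W) (V , V-open , W⊆V , V⊆W) →
          V , V-open , W⊆V ∘ W′⊆W , W⊆W′ ∘ V⊆W
      ; open-full = U , open-full , id , id
      ; open-∩    = λ (V , V-open , W⊆V , V⊆W) (V′ , V′-open , W′⊆V′ , V′⊆W′) →
          V ∩ V′ , open-∩ V-open V′-open ,
          (λ (p , q) → W⊆V p , W′⊆V′ q) , λ (p , q) → V⊆W p , V′⊆W′ q
      ; open-⋃    = λ I W W-open →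
          ⋃ I (λ i → proj₁ (W-open i)) , open-⋃ I _ (λ i → proj₁ (proj₂ (W-open i))) ,
          (λ (i , p) → i , proj₁ (proj₂ (proj₂ (W-open i))) p) ,
          λ (i , p) → i , proj₂ (proj₂ (proj₂ (W-open i))) p
      }

    subgroup : TopologicalGroup ℓ
    subgroup = record
      { group         = subgroup-group
      ; topology      = subspace
      ; ∙-continuous  = λ (V , V-open , W⊆V , V⊆W) →
          (λ (x≈x′ , y≈y′) xy∈W → V⊆W (open-≈ V-open (∙-cong x≈x′ y≈y′) (W⊆V xy∈W))) ,
          λ xy∈W → let O , P , O-open , P-open , x∈O , y∈P , sub = ∙-box H V-open (W⊆V xy∈W) in
            proj₁ ⊢ O , proj₁ ⊢ P , (O , O-open , id , id) , (P , P-open , id , id) ,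
            (x∈O , y∈P) , λ (a∈O , b∈P) → V⊆W (sub a∈O b∈P)
      ; ⁻¹-continuous = λ (V , V-open , W⊆V , V⊆W) →
          _⁻¹ ⊢ V , ⁻¹-continuous V-open , W⊆V , V⊆W
      }

    inclusion : ContinuousHom subgroup H
    inclusion = record
      { ⟦_⟧                 = proj₁
      ; isGroupHomomorphism = IsGroupMonomorphism.isGroupHomomorphism inclusion-mono
      ; continuous          = λ V-open → _ , V-open , id , id
      }

    -- A cover of the subgroup is extended to `H` by adding, for each point outside `C`, an open set
    -- missing `C`. The added sets contain no point of `C`, so dropping them from a finite subcover
    -- of `H` leaves one of the subgroup.
    closed⇒compact : (∀ {a} → ExcludedMiddle a) →
      (∀ x → ¬ x ∈ C → ∃[ P ] Open P × x ∈ P × (∀ {y} → y ∈ C → ¬ y ∈ P)) →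
      IsCompactGroup H → IsCompactGroup subgroup
    closed⇒compact em closed (compact , hausdorff) = sub-compact , sub-hausdorff
      where
      sub-compact : Compact subspace
      sub-compact I W W-open cover =
        let js , js-cover = compact J V V-open V-cover in
        mapMaybe isInj₁ js , λ (x , x∈C) → restrict x∈C js (js-cover x)
        where
        J = I ⊎ (Σ[ x ∈ Carrier ] ¬ x ∈ C)

        V : J → Pred Carrier ℓ
        V (inj₁ i)         = proj₁ (W-open i)
        V (inj₂ (x , x∉C)) = proj₁ (closed x x∉C)

        V-open : ∀ j → Open (V j)
        V-open (inj₁ i)         = proj₁ (proj₂ (W-open i))
        V-open (inj₂ (x , x∉C)) = proj₁ (proj₂ (closed x x∉C))

        V-cover : ∀ x → x ∈ ⋃ _ V
        V-cover x with em {P = x ∈ C}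
        ... | yes x∈C = let i , x∈W = cover (x , x∈C) in
                        inj₁ i , proj₁ (proj₂ (proj₂ (W-open i))) x∈W
        ... | no  x∉C = inj₂ (x , x∉C) , proj₁ (proj₂ (proj₂ (closed x x∉C)))

        restrict : ∀ {x} (x∈C : x ∈ C) js → Any (λ j → x ∈ V j) js →
                   Any (λ i → (x , x∈C) ∈ W i) (mapMaybe isInj₁ js)
        restrict x∈C (inj₁ i ∷ js)         (here x∈V)  = here (proj₂ (proj₂ (proj₂ (W-open i))) x∈V)
        restrict x∈C (inj₁ i ∷ js)         (there any) = there (restrict x∈C js any)
        restrict x∈C (inj₂ (y , y∉C) ∷ js) (here x∈P)  =
          ⊥-elim (proj₂ (proj₂ (proj₂ (closed y y∉C))) x∈C x∈P)
        restrict x∈C (inj₂ _ ∷ js)         (there any) = restrict x∈C js any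

      sub-hausdorff : Hausdorff subspace
      sub-hausdorff (x , _) (y , _) x≉y =
        let V , W , V-open , W-open , x∈V , y∈W , V⊥W = hausdorff x y x≉y in
        proj₁ ⊢ V , proj₁ ⊢ W , (V , V-open , id , id) , (W , W-open , id , id) ,
        x∈V , y∈W , V⊥W

-- Identity and composition of continuous homomorphisms

idʰ : (H : TopologicalGroup ℓ) → ContinuousHom H H
idʰ H = record
  { ⟦_⟧                 = id
  ; isGroupHomomorphism = Identity.isGroupHomomorphism rawGroup refl
  ; continuous          = id
  }
  where open TopologicalGroup H

_∘ʰ_ : {G H K : TopologicalGroup ℓ} → ContinuousHom H K → ContinuousHom G H → ContinuousHom G K
_∘ʰ_ {K = K} ψ χ = record
  { ⟦_⟧                 = λ g → ψ.⟦ χ.⟦ g ⟧ ⟧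
  ; isGroupHomomorphism = Composition.isGroupHomomorphism (TopologicalGroup.trans K)
                            χ.isGroupHomomorphism ψ.isGroupHomomorphism
  ; continuous          = λ V-open → χ.continuous (ψ.continuous V-open)
  }
  where
  module ψ = ContinuousHom ψ
  module χ = ContinuousHom χ

-- Density of the image of the Bohr compactification

module _ (em : ∀ {a} → ExcludedMiddle a) {G B : TopologicalGroup ℓ} (φ : ContinuousHom G B) where
  private
    module G = TopologicalGroup G
    module B = TopologicalGroup B
  open ContinuousHom φ
  open GroupMorphisms G.rawGroup B.rawGroup using (module IsGroupHomomorphism)
  open IsGroupHomomorphism isGroupHomomorphism
    using () renaming (⟦⟧-cong to φ-cong; homo to φ-homo; ε-homo to φ-ε; ⁻¹-homo to φ-⁻¹)

  -- `Adherent` quantifies over open sets, so it lives one level too high to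
  -- carve out a subgroup; excluded middle brings it down.
  ImageClosure : Pred B.Carrier ℓ
  ImageClosure b = Lift ℓ (True (em {P = Adherent B.topology ⟦_⟧ U b}))

  adherent : ∀ {b} → b ∈ ImageClosure → Adherent B.topology ⟦_⟧ U b
  adherent (lift p) = toWitness p

  in-closure : ∀ {b} → Adherent B.topology ⟦_⟧ U b → b ∈ ImageClosure
  in-closure p = lift (fromWitness p)

  image⊆closure : ∀ g → ⟦ g ⟧ ∈ ImageClosure
  image⊆closure g = in-closure λ P _ φg∈P → g , tt , φg∈P

  closure-isSubgroup : IsSubgroup B ImageClosure
  closure-isSubgroup = record
    { ε-closed  = in-closure λ P P-open ε∈P → G.ε , tt , B.open-≈ P-open (B.sym φ-ε) ε∈P
    ; ∙-closed  = λ {x} {y} x∈C y∈C → in-closure λ P P-open xy∈P →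
        let O , Q , O-open , Q-open , x∈O , y∈Q , sub = ∙-box B P-open xy∈P
            g , _ , φg∈O = adherent x∈C O O-open x∈O
            h , _ , φh∈Q = adherent y∈C Q Q-open y∈Q
        in g G.∙ h , tt , B.open-≈ P-open (B.sym (φ-homo g h)) (sub φg∈O φh∈Q)
    ; ⁻¹-closed = λ {x} x∈C → in-closure λ P P-open x⁻¹∈P →
        let g , _ , φg⁻¹∈P = adherent x∈C (B._⁻¹ ⊢ P) (B.⁻¹-continuous P-open) x⁻¹∈P
        in g G.⁻¹ , tt , B.open-≈ P-open (B.sym (φ-⁻¹ g)) φg⁻¹∈P
    }

  closure-closed : ∀ b → ¬ b ∈ ImageClosure →
    ∃[ P ] B.Open P × b ∈ P × (∀ {c} → c ∈ ImageClosure → ¬ c ∈ P)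
  closure-closed b b∉C with adherent-or-separated B.topology ⟦_⟧ em U b
  ... | inj₁ b-adh = ⊥-elim (b∉C (in-closure b-adh))
  ... | inj₂ (P , P-open , b∈P , avoids) = P , P-open , b∈P , λ c∈C c∈P →
    let _ , _ , φg∈P = adherent c∈C P P-open c∈P in avoids tt φg∈P

  closure : TopologicalGroup ℓ
  closure = subgroup B ImageClosure closure-isSubgroup

  corestriction : ContinuousHom G closure
  corestriction = record
    { ⟦_⟧                 = λ g → ⟦ g ⟧ , image⊆closure g
    ; isGroupHomomorphism = record
      { isMonoidHomomorphism = record
        { isMagmaHomomorphism = record
          { isRelHomomorphism = record { cong = φ-cong }
          ; homo              = φ-homo
          }
        ; ε-homo = φ-ε
        }
      ; ⁻¹-homo = φ-⁻¹
      }
    ; continuous = λ (V , V-open , W⊆V , V⊆W) → G.open-≐ (V⊆W , W⊆V) (continuous V-open)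
    }

  -- A factorisation χ of the corestriction, composed with the inclusion, is
  -- the identity on φ(G), hence on B by uniqueness: every b is in the closure.
  bohr⇒dense : IsBohrCompactification {G = G} {B} φ → DenseImage {G = G} {B} φ
  bohr⇒dense bohr b P P-open b∈P =
    adherent (proj₂ (ContinuousHom.⟦ χ ⟧ b)) P P-open (B.open-≈ P-open b≈χb b∈P)
    where
    open IsBohrCompactification bohr

    factorisation = universal
      (closed⇒compact B ImageClosure closure-isSubgroup em closure-closed isCompactGroup)
      corestriction
    χ = proj₁ factorisation

    ι∘χ : ContinuousHom B B
    ι∘χ = _∘ʰ_ {G = B} {closure} {B} (inclusion B ImageClosure closure-isSubgroup) χ

    unique = proj₂ (proj₂ (universal isCompactGroup φ))

    b≈χb : b B.≈ proj₁ (ContinuousHom.⟦ χ ⟧ b)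
    -- `unique` compares the chosen factorisation of `φ` through itself with any other, and so links
    -- the identity to `ι∘χ`.
    b≈χb = B.trans (B.sym (unique {idʰ B} (λ _ → B.refl) b))
                   (unique {ι∘χ} (proj₁ (proj₂ factorisation)) b)

theorem5p5 : (∀ {a} → ExcludedMiddle a) →
    ∀ {ℓ} (G B : TopologicalGroup ℓ) (φ : ContinuousHom G B) →
    IsPolishGroup G → RoelckePrecompact G → IsBohrCompactification φ →
    Surjective (TopologicalGroup._≈_ G) (TopologicalGroup._≈_ B) (ContinuousHom.⟦_⟧ φ)
theorem5p5 em G B φ (_ , metrizable) roelcke bohr b =
  let g , φg≈b = dense⇒surjective em φ metrizable roelcke (IsBohrCompactification.isCompactGroup bohr)
                   (bohr⇒dense em φ bohr) b
  -- `Surjective` asks that every `z ≈ g` be sent to `b`, hence the congruence.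
  in g , λ z≈g → trans (⟦⟧-cong z≈g) φg≈b
  where
  open TopologicalGroup B using (trans)
  open ContinuousHom φ
  open GroupMorphisms (TopologicalGroup.rawGroup G) (TopologicalGroup.rawGroup B) using (module IsGroupHomomorphism)
  open IsGroupHomomorphism isGroupHomomorphism using (⟦⟧-cong)
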